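{- If $H$ is an acyclic digraph on $n$ vertices with maximum degree $\Delta$ and height $h$, then $$\overrightarrow{r_1}(H)\le (\Delta h)^{10\Delta\log h}\,n.$$ In particular, $\overrightarrow{r_1}(H)=O_{h,\Delta}(n)$, i.e. $\overrightarrow{r_1}(H)\le C n$ for a constant $C$ depending only on $h$ and $\Delta$.
   Context: All digraphs are finite, simple and oriented (no loops, parallel or anti-parallel edges). The maximum degree of $H$ is $\max_{v}(|N^+(v)|+|N^-(v)|)$. The height of an acyclic digraph $H$ is the number of vertices on a longest directed path in $H$. A copy of $H$ in $T$ is given by an injective map $V(H)\to V(T)$ sending edges of $H$ to edges of $T$ with orientations preserved. $\overrightarrow{r_1}(H)$ is the least $N$ such that every tournament on $N$ vertices contains a copy of $H$. All logarithms are to base $2$. -}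

module Defs where

open import Data.Bool.Base using (Bool; T)
open import Data.Fin.Base using (Fin)
open import Data.Fin.Subset using (Subset; ∣_∣)
open import Data.List.Base using (List; []; _∷_; _∷ʳ_; length; map; allFin)
open import Data.List.Extrema.Nat using (max)
open import Data.List.Relation.Unary.Linked using (Linked)
open import Data.List.Relation.Unary.Unique.Propositional using (Unique)
open import Data.Nat.Base using (ℕ; _+_; _*_; _^_; _≤_; NonZero)
open import Data.Product.Base using (Σ-syntax; ∃-syntax; _×_)
open import Data.Sum.Base using (_⊎_)
open import Data.Vec.Base using (tabulate)
open import Function.Definitions using (Injective)
open import Relation.Binary.Definitions using (Asymmetric)
open import Relation.Binary.PropositionalEquality.Core using (_≡_; _≢_)
open import Relation.Nullary.Negation.Core using (¬_)

-- Asymmetry excludes both loops and anti-parallel edges; parallel edges cannot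
-- occur because adjacency is a Boolean-valued relation.
record Digraph (n : ℕ) : Set where
  field
    adj : Fin n → Fin n → Bool

  _⟶_ : Fin n → Fin n → Set
  u ⟶ v = T (adj u v)

  field
    asym : Asymmetric _⟶_

  N⁺ : Fin n → Subset n
  N⁺ v = tabulate (λ u → adj v u)

  N⁻ : Fin n → Subset n
  N⁻ v = tabulate (λ u → adj u v)

  degree : Fin n → ℕ
  degree v = ∣ N⁺ v ∣ + ∣ N⁻ v ∣

  maxDegree : ℕ
  maxDegree = max 0 (map degree (allFin n))

  IsDirectedPath : List (Fin n) → Set
  IsDirectedPath vs = Unique vs × Linked _⟶_ vs

  -- v ∷ vs lists the vertices of the cycle once each; the last one has an edge
  -- back to v.
  IsDirectedCycle : Fin n → List (Fin n) → Set
  IsDirectedCycle v vs = Unique (v ∷ vs) × Linked _⟶_ ((v ∷ vs) ∷ʳ v)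

  Acyclic : Set
  Acyclic = ∀ v vs → ¬ IsDirectedCycle v vs

  -- The number of vertices on a longest directed path is h.
  HasHeight : ℕ → Set
  HasHeight h = (∃[ vs ] IsDirectedPath vs × length vs ≡ h)
              × (∀ vs → IsDirectedPath vs → length vs ≤ h)

  IsTournament : Set
  IsTournament = ∀ {u v} → u ≢ v → (u ⟶ v) ⊎ (v ⟶ u)

open Digraph public using (maxDegree; Acyclic; HasHeight; IsTournament)

Copy : ∀ {n N} → Digraph n → Digraph N → Set
Copy {n} {N} H G =
  Σ[ f ∈ (Fin n → Fin N) ]
    Injective _≡_ _≡_ f ×
    (∀ {u v} → Digraph._⟶_ H u v → Digraph._⟶_ G (f u) (f v))

InEveryTournament : ∀ {n} → Digraph n → ℕ → Set
InEveryTournament H N = (G : Digraph N) → IsTournament G → Copy H G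

-- r is the one-colour oriented Ramsey number of H.
IsRamseyNumber : ∀ {n} → Digraph n → ℕ → Set
IsRamseyNumber H r =
  InEveryTournament H r × (∀ N → InEveryTournament H N → r ≤ N)

-- r ≤⟦ b ^⟨ k log₂ h ⟩· n ⟧ is the real inequality  r ≤ b ^ (k · log₂ h) · n,
-- with the (in general irrational) exponent read through its upper rational cut:
-- log₂ h ≤ p / q  iff  h ^ q ≤ 2 ^ p, and  r ≤ b ^ (k · p / q) · n  iff
-- r ^ q ≤ b ^ (k · p) · n ^ q.  For h ≥ 1 and b ≥ 1 the right-hand side is
-- continuous and nondecreasing in the exponent, so the inequality at log₂ h is
-- equivalent to the inequality at every rational p / q ≥ log₂ h.  If k = 0 the
-- power is 1, also for b = 0 (0 ^ 0 = 1): this occurs for edgeless digraphs.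
-- For n = 0 (where h = 0) it just says r = 0.
_≤⟦_^⟨_log₂_⟩·_⟧ : ℕ → ℕ → ℕ → ℕ → ℕ → Set
r ≤⟦ b ^⟨ k log₂ h ⟩· n ⟧ =
  ∀ p q → .{{NonZero q}} → h ^ q ≤ 2 ^ p → r ^ q ≤ b ^ (k * p) * n ^ q

{-# OPTIONS --safe #-}
module Submission where

-- A tournament G either contains H or has large vertex sets X, Y between which almost all
-- edges go one way: embed H greedily, keeping for each unplaced vertex the candidates that
-- are consistent with its placed neighbours, and look at the step where every choice shrinks
-- some candidate set too much. Applying this inside X and inside a suitable half of Y, and so
-- on ⌈log₂ h⌉ times at the cost of a factor (Δh) ^ O(Δ) each, gives 2 ^ ⌈log₂ h⌉ ≥ h clusters
-- such that, for any two of them, almost all edges go from the later to the earlier one.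
-- Placing every vertex of H in the cluster indexed by the length of a longest walk from it,
-- a second greedy argument embeds H.

open import Data.Bool.Base using (Bool; T; false; true)
open import Data.Bool.Properties using (T?)
open import Data.Fin.Base as Fin using (Fin; fromℕ<; suc; zero)
open import Data.Fin.Properties as Fin using () renaming (<-cmp to <ᶠ-cmp; _<?_ to _<ᶠ?_; _≟_ to _≟ᶠ_)
open import Data.Fin.Subset using (∣_∣)
open import Data.Fin.Subset.Properties using (anySubset?)
open import Data.List.Base using (List; []; _++_; _∷_; _∷ʳ_; allFin; filter; length; lookup; map; tabulate)
open import Data.List.Extrema.Nat using (xs≤max)
open import Data.List.Membership.Propositional using (_∈_; _∉_; find; lose)
open import Data.List.Membership.Propositional.Properties using (∈-allFin; ∈-filter⁺; ∈-filter⁻; ∈-length; ∈-lookup; ∈-map⁺)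
open import Data.List.Properties using (filter-all; filter-none; length-++; length-map; length-tabulate)
open import Data.List.Relation.Unary.All as All using (All; []; _∷_)
open import Data.List.Relation.Unary.All.Properties as All using (¬All⇒Any¬; ¬Any⇒All¬)
open import Data.List.Relation.Unary.AllPairs using (AllPairs; []; _∷_)
open import Data.List.Relation.Unary.AllPairs.Properties as AllPairs using ()
open import Data.List.Relation.Unary.Any as Any using (Any; any?; here; there)
open import Data.List.Relation.Unary.Linked using (Linked; [-]; []; _∷_)
open import Data.List.Relation.Unary.Unique.Propositional using (Unique)
open import Data.List.Relation.Unary.Unique.Propositional.Properties using (allFin⁺; filter⁺)
open import Data.Nat.Base using (>-nonZero; >-nonZero⁻¹; NonZero; _*_; _+_; _<_; _^_; _∸_; _≤_; pred; suc; s≤s; zero; z≤n; ℕ)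
open import Data.Nat.ListAction using (sum)
open import Data.Nat.Properties
open import Data.Nat.Tactic.RingSolver using (solve-∀)
open import Data.Product.Base using (_,_; _×_; proj₁; proj₂; ∃; Σ-syntax; ∃-syntax)
open import Data.Sum.Base using ([_,_]′; _⊎_; inj₁; inj₂; swap)
open import Data.Unit.Base using (tt; ⊤)
open import Data.Vec.Base as Vec using (Vec; []; _∷_)
open import Data.Vec.Properties using (lookup∘tabulate)
open import Defs
open import Function.Base using (_∘_; flip; id)
open import Function.Definitions using (Injective)
open import Level using (0ℓ)
open import Relation.Binary.Definitions using (DecidableEquality; Symmetric; tri<; tri>; tri≈)
open import Relation.Binary.PropositionalEquality
open import Relation.Nullary.Decidable using (Dec; _×-dec_; _→-dec_; _⊎-dec_; decidable-stable; map′; no; yes; ¬?)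
open import Relation.Nullary.Negation using (contradiction; ¬_)
open import Relation.Unary using (Decidable; Pred)

-- The sparsity that a stuck greedy step yields is one-sided: each `x` in X misses few vertices of
-- Y. This passes to subsets of X, but a small subset of Y may collect all the missing edges. Hence
-- the order of the recursion: clusters are built in X first, then every `y` missing too much of
-- some cluster is deleted, and only then are clusters built in what remains of Y. The density of
-- missing edges rises once, from 1/`d` to 1/`D`, and does not decay from level to level, so one `d`
-- serves all depths. With K = ⌈log h⌉, `D` = 2 · 2^K · 4(Δ+1) is what the final embedding needs,
-- and `d` = 2^K · `D` pays for the deletions; here Δ+1 is the maximum degree. A level costs a
-- factor of order `d` ^ Δ and not `d` ^ (Δ+1), because in a stuck step both ends of an edge are
-- unplaced. This saving matters: `d` is bounded by the fifth power of (Δ+1)h, and for heights 3 and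
-- 4 the resulting exponent fits under 10(Δ+1) with a slack of only 1.

private variable
  A B I : Set

-- Counting: union bound, double counting, averaging

count : {P : Pred A 0ℓ} → Decidable P → List A → ℕ
count P? xs = length (filter P? xs)

∑ : List A → (A → ℕ) → ℕ
∑ xs f = sum (map f xs)

module _ {P : Pred A 0ℓ} (P? : Decidable P) where

  count-all : ∀ {xs} → All P xs → count P? xs ≡ length xs
  count-all = cong length ∘ filter-all P?

  count-none : ∀ {xs} → All (¬_ ∘ P) xs → count P? xs ≡ 0
  count-none = cong length ∘ filter-none P?

  count-some : ∀ xs → count P? xs < length xs → ∃[ x ] x ∈ xs × ¬ P x
  count-some xs c< with All.all? P? xs
  ... | yes all = contradiction c< (≤⇒≯ (≤-reflexive (sym (count-all all))))
  ... | no ¬all = find (¬All⇒Any¬ P? xs ¬all)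

  count-¬ : ∀ xs → length xs ≡ count P? xs + count (¬? ∘ P?) xs
  count-¬ []       = refl
  count-¬ (x ∷ xs) with P? x
  ... | yes _ = cong suc (count-¬ xs)
  ... | no  _ = trans (cong suc (count-¬ xs)) (sym (+-suc _ _))

  count-⊎ : {Q R : Pred A 0ℓ} (Q? : Decidable Q) (R? : Decidable R) → (∀ {x} → P x → Q x ⊎ R x) →
            ∀ xs → count P? xs ≤ count Q? xs + count R? xs
  count-⊎ Q? R? split []       = z≤n
  count-⊎ Q? R? split (x ∷ xs) with P? x | Q? x | R? x | count-⊎ Q? R? split xs
  ... | no _  | no _  | no _  | ih = ih
  ... | no _  | no _  | yes _ | ih = ≤-trans ih (+-monoʳ-≤ _ (n≤1+n _))
  ... | no _  | yes _ | no _  | ih = m≤n⇒m≤1+n ih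
  ... | no _  | yes _ | yes _ | ih = m≤n⇒m≤1+n (≤-trans ih (+-monoʳ-≤ _ (n≤1+n _)))
  ... | yes _ | yes _ | no _  | ih = s≤s ih
  ... | yes _ | yes _ | yes _ | ih = s≤s (≤-trans ih (+-monoʳ-≤ _ (n≤1+n _)))
  ... | yes _ | no _  | yes _ | ih = ≤-trans (s≤s ih) (≤-reflexive (sym (+-suc _ _)))
  ... | yes p | no ¬q | no ¬r | ih with split p
  ...   | inj₁ q = contradiction q ¬q
  ...   | inj₂ r = contradiction r ¬r

  count-mono : {Q : Pred A 0ℓ} (Q? : Decidable Q) → (∀ {x} → P x → Q x) → ∀ xs → count P? xs ≤ count Q? xs
  count-mono Q? P⇒Q []       = z≤n
  count-mono Q? P⇒Q (x ∷ xs) with P? x | Q? x | count-mono Q? P⇒Q xs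
  ... | no _  | no _  | ih = ih
  ... | no _  | yes _ | ih = m≤n⇒m≤1+n ih
  ... | yes _ | yes _ | ih = s≤s ih
  ... | yes p | no ¬q | ih = contradiction (P⇒Q p) ¬q

  markov : ∀ {f : A → ℕ} {t} → (∀ {x} → P x → t ≤ f x) → ∀ xs → count P? xs * t ≤ ∑ xs f
  markov t≤f []       = z≤n
  markov t≤f (x ∷ xs) with P? x
  ... | yes p = +-mono-≤ (t≤f p) (markov t≤f xs)
  ... | no _  = ≤-trans (markov t≤f xs) (m≤n+m _ _)

∑-*-≤ : ∀ {f : A → ℕ} {d t} xs → (∀ {x} → x ∈ xs → f x * d ≤ t) → ∑ xs f * d ≤ length xs * t
∑-*-≤ []       f≤ = z≤n
∑-*-≤ {f = f} {d} {t} (x ∷ xs) f≤ = begin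
  (f x + ∑ xs f) * d     ≡⟨ *-distribʳ-+ d (f x) (∑ xs f) ⟩
  f x * d + ∑ xs f * d   ≤⟨ +-mono-≤ (f≤ (here refl)) (∑-*-≤ xs (f≤ ∘ there)) ⟩
  t + length xs * t      ∎
  where open ≤-Reasoning

∑-*-distrib : ∀ (f : A → ℕ) t xs → ∑ xs (λ x → f x * t) ≡ ∑ xs f * t
∑-*-distrib f t []       = refl
∑-*-distrib f t (x ∷ xs) = trans (cong (f x * t +_) (∑-*-distrib f t xs)) (sym (*-distribʳ-+ t (f x) _))

module _ {R : A → B → Set} (R? : ∀ x y → Dec (R x y)) where

  private
    +-swap : ∀ a b c → a + (b + c) ≡ b + (a + c)
    +-swap = solve-∀

    count-∷ : ∀ x xs ys → ∑ ys (λ y → count (λ x → R? x y) (x ∷ xs)) ≡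
                          count (R? x) ys + ∑ ys (λ y → count (λ x → R? x y) xs)
    count-∷ x xs []       = refl
    count-∷ x xs (y ∷ ys) with R? x y | count-∷ x xs ys
    ... | yes _ | ih = cong suc (trans (cong (column y +_) ih) (+-swap (column y) (count (R? x) ys) (∑ ys column)))
      where column = λ y → count (λ x → R? x y) xs
    ... | no _  | ih = trans (cong (column y +_) ih) (+-swap (column y) (count (R? x) ys) (∑ ys column))
      where column = λ y → count (λ x → R? x y) xs

    ∑-zero : ∀ (ys : List B) → ∑ ys (λ _ → 0) ≡ 0
    ∑-zero []       = refl
    ∑-zero (_ ∷ ys) = ∑-zero ys

  double-count : ∀ xs ys → ∑ xs (λ x → count (R? x) ys) ≡ ∑ ys (λ y → count (λ x → R? x y) xs)
  double-count []       ys = sym (∑-zero ys)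
  double-count (x ∷ xs) ys = trans (cong (count (R? x) ys +_) (double-count xs ys)) (sym (count-∷ x xs ys))

-- Union bound. Shares are expressed without division here and below: `c * d ≤ l` says that `c` is
-- at most a 1/`d` share of `l`.
count-any : ∀ {R : I → A → Set} (R? : ∀ i → Decidable (R i)) {d t} is xs →
            (∀ {i} → i ∈ is → count (R? i) xs * d ≤ t) →
            count (λ x → any? (λ i → R? i x) is) xs * d ≤ length is * t
count-any R? [] xs _ = ≤-reflexive (cong (_* _) (count-none (λ x → any? (λ i → R? i x) []) (All.universal (λ _ ()) xs)))
count-any R? {d} {t} (i ∷ is) xs bound = begin
  count (any-R? (i ∷ is)) xs * d                     ≤⟨ *-monoˡ-≤ d (count-⊎ _ (R? i) (any-R? is) Any.toSum xs) ⟩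
  (count (R? i) xs + count (any-R? is) xs) * d       ≡⟨ *-distribʳ-+ d (count (R? i) xs) _ ⟩
  count (R? i) xs * d + count (any-R? is) xs * d     ≤⟨ +-mono-≤ (bound (here refl)) (count-any R? is xs (bound ∘ there)) ⟩
  t + length is * t                                  ∎
  where
  open ≤-Reasoning
  any-R? = λ is x → any? (λ i → R? i x) is

-- If every `i` covered less than a 1/`m` share, hence `m * count` at most `length xs` minus one,
-- the union bound would leave part of `xs` uncovered.
pigeonhole : ∀ {R : I → A → Set} (R? : ∀ i → Decidable (R i)) is xs m → 0 < length xs → length is ≤ m →
             (∀ {x} → x ∈ xs → Any (λ i → R i x) is) →
             ∃[ i ] i ∈ is × length xs ≤ m * count (R? i) xs
pigeonhole R? is xs@(_ ∷ xs′) m _ is≤m covered with any? (λ i → length xs ≤? m * count (R? i) xs) is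
... | yes found = let i , i∈is , large = find found in i , i∈is , large
... | no none = contradiction full (<⇒≱ short)
  where
  open ≤-Reasoning
  any-R? = λ x → any? (λ i → R? i x) is

  full : length xs * m ≤ length is * length xs′
  full = begin
    length xs * m       ≡⟨ cong (_* m) (count-all any-R? (All.tabulate covered)) ⟨
    count any-R? xs * m ≤⟨ count-any R? is xs small ⟩
    length is * length xs′ ∎
    where
    small : ∀ {i} → i ∈ is → count (R? i) xs * m ≤ length xs′
    small {i} i∈is = ≤-pred (begin-strict
      count (R? i) xs * m ≡⟨ *-comm (count (R? i) xs) m ⟩
      m * count (R? i) xs <⟨ ≰⇒> (λ large → none (lose i∈is large)) ⟩
      length xs           ∎)

  short : length is * length xs′ < length xs * m
  short = begin-strict
    length is * length xs′ ≤⟨ *-monoˡ-≤ (length xs′) is≤m ⟩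
    -- Strict since `m` is positive: the head of `xs` is covered, so `is` has an element.
    m * length xs′         <⟨ m<n+m (m * length xs′) (≤-trans (∈-length (proj₁ (proj₂ (find (covered (here refl)))))) is≤m) ⟩
    m + m * length xs′     ≡⟨ *-suc m (length xs′) ⟨
    m * length xs          ≡⟨ *-comm m (length xs) ⟩
    length xs * m          ∎

module _ (_≟_ : DecidableEquality A) where

  open import Data.List.Membership.DecPropositional _≟_ using (_∈?_)

  private
    count-≡ : ∀ u {xs} → Unique xs → count (u ≟_) xs ≤ 1
    count-≡ u []               = z≤n
    count-≡ u {x ∷ xs} (x∉ ∷ uniq) with u ≟ x
    ... | yes refl = s≤s (≤-reflexive (count-none (u ≟_) x∉))
    ... | no _     = count-≡ u uniq

  count-∈ : ∀ us {xs} → Unique xs → count (_∈? us) xs ≤ length us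
  count-∈ us {xs} uniq = subst₂ _≤_ (*-identityʳ _) (*-identityʳ _)
    (≤-trans (*-monoˡ-≤ 1 (count-mono (_∈? us) (λ x → any? (_≟ x) us) (Any.map sym) xs))
             (count-any _≟_ us xs λ {u} _ → ≤-trans (≤-reflexive (*-identityʳ _)) (count-≡ u uniq)))

module _ {R : I → A → B → Set} (R? : ∀ i x y → Dec (R i x y)) (block : I → List B) where

  abstract
    atypical? : ∀ t i x → Dec (length (block i) < count (R? i x) (block i) * t)
    atypical? t i x = length (block i) <? count (R? i x) (block i) * t

  -- The average density of `R` towards each block is at most 1/`D`, so by Markov at most a `t`/`D`
  -- share of `xs` exceeds density 1/`t` there. The union bound over the blocks then costs at most
  -- half of `xs`, which is the choice `2 * length is * t ≤ D`.
  count-atypical : ∀ {t D} .{{_ : NonZero t}} is xs → 2 * length is * t ≤ D →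
    (∀ {i} → i ∈ is → 0 < length (block i)) →
    (∀ {i} → i ∈ is → ∑ xs (λ x → count (R? i x) (block i)) * D ≤ length xs * length (block i)) →
    count (λ x → any? (λ i → atypical? t i x) is) xs * 2 ≤ length xs
  -- Separate because the general case cancels the factor `length is`.
  count-atypical [] xs _ _ _ = subst (_≤ length xs)
    (sym (cong (_* 2) (count-none (λ x → any? (λ i → atypical? _ i x) []) (All.universal (λ _ ()) xs)))) z≤n
  count-atypical {t} {D} {{t≢0}} is@(_ ∷ _) xs big nonempty sparse = *-cancelˡ-≤ (length is) (begin
    length is * (c * 2)        ≡⟨ rearrange₁ (length is) c ⟩
    c * (2 * length is)        ≤⟨ count-any (atypical? t) is xs each ⟩
    length is * length xs      ∎)
    where
    open ≤-Reasoning
    c = count (λ x → any? (λ i → atypical? t i x) is) xs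
    rearrange₁ : ∀ m c → m * (c * 2) ≡ c * (2 * m)
    rearrange₁ = solve-∀
    rearrange₂ : ∀ a m t b → a * m * (t * b) ≡ a * b * (m * t)
    rearrange₂ = solve-∀
    rearrange₃ : ∀ s t D → s * t * D ≡ t * (s * D)
    rearrange₃ = solve-∀
    rearrange₄ : ∀ t l b → t * (l * b) ≡ l * (t * b)
    rearrange₄ = solve-∀
    each : ∀ {i} → i ∈ is → count (atypical? t i) xs * (2 * length is) ≤ length xs
    each {i} i∈is = *-cancelʳ-≤ _ _ (t * b) {{m*n≢0 t b {{t≢0}} {{>-nonZero (nonempty i∈is)}}}} (begin
      a * (2 * length is) * (t * b)       ≡⟨ rearrange₂ a (2 * length is) t b ⟩
      a * b * (2 * length is * t)         ≤⟨ *-mono-≤ (markov (atypical? t i) <⇒≤ xs) big ⟩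
      ∑ xs (λ x → f x * t) * D            ≡⟨ cong (_* D) (∑-*-distrib f t xs) ⟩
      ∑ xs f * t * D                      ≡⟨ rearrange₃ (∑ xs f) t D ⟩
      t * (∑ xs f * D)                    ≤⟨ *-monoʳ-≤ t (sparse i∈is) ⟩
      t * (length xs * b)                 ≡⟨ rearrange₄ t (length xs) b ⟩
      length xs * (t * b)                 ∎)
      where
      a = count (atypical? t i) xs
      b = length (block i)
      f = λ x → count (R? i x) (block i)

AllPairs-lookup : ∀ {A : Set} {R : A → A → Set} {xs x y} → Symmetric R → AllPairs R xs →
                  x ∈ xs → y ∈ xs → x ≡ y ⊎ R x y
AllPairs-lookup sym-R (Rx ∷ _)  (here refl) (here refl) = inj₁ refl
AllPairs-lookup sym-R (Rx ∷ _)  (here refl) (there y∈)  = inj₂ (All.lookup Rx y∈)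
AllPairs-lookup sym-R (Rx ∷ _)  (there x∈)  (here refl) = inj₂ (sym-R (All.lookup Rx x∈))
AllPairs-lookup sym-R (_ ∷ pxs) (there x∈)  (there y∈)  = AllPairs-lookup sym-R pxs x∈ y∈

-- Greedy embedding, one vertex at a time

module _ {n} (H : Digraph n) where

  open Digraph H using (_⟶_)

  Adjacent : Fin n → Fin n → Set
  Adjacent u v = u ⟶ v ⊎ v ⟶ u

  abstract
    adjacent? : ∀ u v → Dec (Adjacent u v)
    adjacent? u v = T? _ ⊎-dec T? _

  valency : Fin n → List (Fin n) → ℕ
  valency v = count (adjacent? v)

module _ {n N} (H : Digraph n) (G : Digraph N) where

  open Digraph H using () renaming (_⟶_ to _⟶ᴴ_; asym to asymᴴ)
  open Digraph G using () renaming (_⟶_ to _⟶ᴳ_)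

  Placement : Set
  Placement = List (Fin n × Fin N)

  placedValency : Fin n → Placement → ℕ
  placedValency v = count (adjacent? H v ∘ proj₁)

  Compatible : Fin n × Fin N → Fin n × Fin N → Set
  Compatible (v , x) (w , z) = x ≢ z × (v ⟶ᴴ w → x ⟶ᴳ z) × (w ⟶ᴴ v → z ⟶ᴳ x)

  module _ {Fail : Set} {Δ : ℕ} (Inv : Placement → List (Fin n) → Set)
    (step : ∀ P v L → length P + length (v ∷ L) ≤ n →
            (∀ w → placedValency w P + valency H w (v ∷ L) ≤ Δ) → Inv P (v ∷ L) →
            (∃[ x ] All (Compatible (v , x)) P × Inv ((v , x) ∷ P) L) ⊎ Fail) where

    private
      extract : ∀ {P} → AllPairs Compatible P → (∀ v → ∃[ x ] (v , x) ∈ P) → Copy H G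
      extract {P} compatible placed = f , injective , λ {u} {v} → preserves u v
        where
        f = proj₁ ∘ placed
        related : ∀ u v → u ≡ v ⊎ Compatible (u , f u) (v , f v)
        related u v with AllPairs-lookup (λ (≢ , to , from) → ≢ ∘ sym , from , to)
                           compatible (proj₂ (placed u)) (proj₂ (placed v))
        ... | inj₁ eq = inj₁ (cong proj₁ eq)
        ... | inj₂ c  = inj₂ c
        injective : ∀ {u v} → f u ≡ f v → u ≡ v
        injective {u} {v} eq with related u v
        ... | inj₁ u≡v     = u≡v
        ... | inj₂ (≢ , _) = contradiction eq ≢
        preserves : ∀ u v → u ⟶ᴴ v → f u ⟶ᴳ f v
        preserves u v u⟶v with related u v
        ... | inj₁ refl           = contradiction u⟶v (asymᴴ u⟶v)
        ... | inj₂ (_ , edge , _) = edge u⟶v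

      transfer : ∀ w v {x} P L → placedValency w ((v , x) ∷ P) + valency H w L ≡
                                 placedValency w P + valency H w (v ∷ L)
      transfer w v P L with adjacent? H w v
      ... | yes _ = sym (+-suc _ _)
      ... | no _  = refl

      run : ∀ P L → AllPairs Compatible P → (∀ v → (∃[ x ] (v , x) ∈ P) ⊎ v ∈ L) →
            length P + length L ≤ n → (∀ w → placedValency w P + valency H w L ≤ Δ) →
            Inv P L → Copy H G ⊎ Fail
      run P [] compatible cover _ _ _ = inj₁ (extract compatible placed)
        where
        placed : ∀ v → ∃[ x ] (v , x) ∈ P
        placed v with cover v
        ... | inj₁ done = done
      run P (v ∷ L) compatible cover len deg inv with step P v L len deg inv
      ... | inj₂ fail              = inj₂ fail
      ... | inj₁ (x , ext , inv′) =
        run ((v , x) ∷ P) L (ext ∷ compatible) cover′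
            (≤-trans (≤-reflexive (sym (+-suc _ _))) len)
            (λ w → ≤-trans (≤-reflexive (transfer w v P L)) (deg w)) inv′
        where
        cover′ : ∀ w → (∃[ y ] (w , y) ∈ (v , x) ∷ P) ⊎ w ∈ L
        cover′ w with cover w
        ... | inj₁ (y , ∈P)     = inj₁ (y , there ∈P)
        ... | inj₂ (here refl)  = inj₁ (x , here refl)
        ... | inj₂ (there w∈L)  = inj₂ w∈L

    -- Shared by both embeddings; `Fail` is whatever a stuck step can deliver instead. Placing a
    -- vertex moves it from the unplaced to the placed neighbours of others, so the sum of the two
    -- valencies is invariant (`transfer`) and stays bounded by `Δ`.
    greedy : (∀ w → valency H w (allFin n) ≤ Δ) → Inv [] (allFin n) → Copy H G ⊎ Fail
    greedy = run [] (allFin n) [] (inj₂ ∘ ∈-allFin) (≤-reflexive (length-tabulate id))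

  -- A stuck embedding yields a sparse pair

  Sparse→ Sparse← : ℕ → List (Fin N) → List (Fin N) → Set
  Sparse→ d X Y = ∀ {x} → x ∈ X → count (λ y → ¬? (T? (Digraph.adj G x y))) Y * d ≤ length Y
  Sparse← d X Y = ∀ {x} → x ∈ X → count (λ y → ¬? (T? (Digraph.adj G y x))) Y * d ≤ length Y

  -- Here and below the degrees in H are at most suc Δ.
  record SparsePair (Δ d : ℕ) (S : List (Fin N)) : Set where
    field
      X Y      : List (Fin N)
      X-unique : Unique X
      Y-unique : Unique Y
      X⊆S      : ∀ {x} → x ∈ X → x ∈ S
      Y⊆S      : ∀ {y} → y ∈ Y → y ∈ S
      X-large  : length S ≤ length X * (2 * suc Δ * d ^ Δ)
      Y-large  : length S ≤ length Y * d ^ Δ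
      sparse   : Sparse→ d X Y ⊎ Sparse← d X Y

  module _ (tournament : IsTournament G) {Δ d : ℕ} .{{_ : NonZero d}} (deg : ∀ w → valency H w (allFin n) ≤ suc Δ)
    (S : List (Fin N)) (S-unique : Unique S) (S-large : 2 * n * d ^ suc Δ ≤ length S) where

    private
      -- Only the reverse edges are excluded: y = x is allowed, which costs nothing because
      -- used vertices are discarded anyway, and turns failure into a bound on non-edges.
      Allows : Fin n → Fin N → Fin n → Fin N → Set
      Allows v x u y = (v ⟶ᴴ u → ¬ y ⟶ᴳ x) × (u ⟶ᴴ v → ¬ x ⟶ᴳ y)

      allows? : ∀ v x u y → Dec (Allows v x u y)
      allows? v x u y = (T? _ →-dec ¬? (T? _)) ×-dec (T? _ →-dec ¬? (T? _))

      candidates : Placement → Fin n → List (Fin N)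
      candidates []            u = S
      candidates ((v , x) ∷ P) u = filter (allows? v x u) (candidates P u)

      candidates-unique : ∀ P u → Unique (candidates P u)
      candidates-unique []            u = S-unique
      candidates-unique ((v , x) ∷ P) u = filter⁺ (allows? v x u) (candidates-unique P u)

      candidates-⊆ : ∀ P u {y} → y ∈ candidates P u → y ∈ S
      candidates-⊆ []            u y∈ = y∈
      candidates-⊆ ((v , x) ∷ P) u y∈ = candidates-⊆ P u (proj₁ (∈-filter⁻ (allows? v x u) y∈))

      candidates-allowed : ∀ P u {y} → y ∈ candidates P u → All (λ (v , x) → Allows v x u y) P
      candidates-allowed []            u y∈ = []
      candidates-allowed ((v , x) ∷ P) u y∈ with ∈-filter⁻ (allows? v x u) y∈
      ... | y∈′ , ok = ok ∷ candidates-allowed P u y∈′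

      -- Each placed neighbour of `u` may cost its candidate set a factor `d`; all other placements
      -- cost nothing.
      Inv : Placement → List (Fin n) → Set
      Inv P L = ∀ {u} → u ∈ L → length S ≤ length (candidates P u) * d ^ placedValency u P

      step : ∀ P v L → length P + length (v ∷ L) ≤ n →
             (∀ w → placedValency w P + valency H w (v ∷ L) ≤ suc Δ) → Inv P (v ∷ L) →
             (∃[ x ] All (Compatible (v , x)) P × Inv ((v , x) ∷ P) L) ⊎ SparsePair Δ d S
      step P v L len deg inv = result
        where
        open ≤-Reasoning
        open import Data.List.Membership.DecPropositional (_≟ᶠ_ {N}) using (_∈?_)

        used = map proj₂ P
        fresh = filter (λ x → ¬? (x ∈? used)) (candidates P v)
        later = filter (adjacent? H v) L

        Bad : Fin n → Fin N → Set
        Bad u x = count (allows? v x u) (candidates P u) * d < length (candidates P u)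

        bad? : ∀ u x → Dec (Bad u x)
        bad? u x = count (allows? v x u) (candidates P u) * d <? length (candidates P u)

        used-bound : length P < n
        used-bound = ≤-trans (≤-trans (≤-reflexive (+-comm 1 (length P))) (+-monoʳ-≤ (length P) (s≤s z≤n))) len

        -- Even with `suc Δ` neighbours of `v` placed, `2 * n` candidates survive. As fewer than `n`
        -- vertices are used, at least half of the candidates are fresh; this is the factor 2 in
        -- `X-large`.
        candidates-large : 2 * n ≤ length (candidates P v)
        candidates-large = *-cancelʳ-≤ _ _ (d ^ suc Δ) {{m^n≢0 d (suc Δ)}} (begin
          2 * n * d ^ suc Δ                            ≤⟨ S-large ⟩
          length S                                     ≤⟨ inv (here refl) ⟩
          length (candidates P v) * d ^ placedValency v P
            ≤⟨ *-monoʳ-≤ (length (candidates P v)) (^-monoʳ-≤ d (≤-trans (m≤m+n (placedValency v P) _) (deg v))) ⟩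
          length (candidates P v) * d ^ suc Δ          ∎)

        split : length (candidates P v) ≤ n + length fresh
        split = begin
          length (candidates P v)                        ≡⟨ count-¬ (_∈? used) (candidates P v) ⟩
          count (_∈? used) (candidates P v) + length fresh
            ≤⟨ +-monoˡ-≤ (length fresh) (count-∈ _≟ᶠ_ used (candidates-unique P v)) ⟩
          length used + length fresh                     ≡⟨ cong (_+ length fresh) (length-map proj₂ P) ⟩
          length P + length fresh                        ≤⟨ +-monoˡ-≤ (length fresh) (<⇒≤ used-bound) ⟩
          n + length fresh                               ∎

        fresh-n : n ≤ length fresh
        fresh-n = +-cancelˡ-≤ n _ _ (≤-trans (≤-trans (≤-reflexive (cong (n +_) (sym (+-identityʳ n)))) candidates-large) split)

        fresh-nonempty : 0 < length fresh
        fresh-nonempty = ≤-trans (≤-trans (s≤s z≤n) used-bound) fresh-n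

        fresh-half : length (candidates P v) ≤ 2 * length fresh
        fresh-half = ≤-trans split (≤-trans (+-monoˡ-≤ (length fresh) fresh-n)
                       (≤-reflexive (cong (length fresh +_) (sym (+-identityʳ _)))))

        later-few : length later ≤ suc Δ
        later-few = ≤-trans (≤-trans (later≤ (adjacent? H v v)) (m≤n+m _ _)) (deg v)
          where
          later≤ : Dec (Adjacent H v v) → length later ≤ valency H v (v ∷ L)
          later≤ _ with adjacent? H v v
          ... | yes _ = n≤1+n _
          ... | no _  = ≤-refl

        compatible : ∀ {x} → x ∈ fresh → All (Compatible (v , x)) P
        compatible {x} x∈ with ∈-filter⁻ (λ x → ¬? (x ∈? used)) x∈
        ... | x∈C , x∉used = All.tabulate λ {(w , z)} wz∈P →
          let x≢z = λ x≡z → x∉used (subst (_∈ used) (sym x≡z) (∈-map⁺ proj₂ wz∈P))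
              (in-ok , out-ok) = All.lookup (candidates-allowed P v x∈C) wz∈P
          in x≢z , (λ v⟶w → forced x≢z (out-ok v⟶w)) , (λ w⟶v → forced (x≢z ∘ sym) (in-ok w⟶v))
          where
          forced : ∀ {x z} → x ≢ z → ¬ z ⟶ᴳ x → x ⟶ᴳ z
          forced x≢z ¬zx with tournament x≢z
          ... | inj₁ xz = xz
          ... | inj₂ zx = contradiction zx ¬zx

        continue : ∀ {x} → All (λ u → ¬ Bad u x) later → Inv ((v , x) ∷ P) L
        continue {x} good {u} u∈L with adjacent? H u v
        ... | yes uv = begin
          length S                                         ≤⟨ inv (there u∈L) ⟩
          length (candidates P u) * d ^ k
            ≤⟨ *-monoˡ-≤ (d ^ k) (≮⇒≥ (All.lookup good (∈-filter⁺ (adjacent? H v) u∈L (swap uv)))) ⟩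
          count (allows? v x u) (candidates P u) * d * d ^ k ≡⟨ *-assoc (count (allows? v x u) (candidates P u)) d (d ^ k) ⟩
          count (allows? v x u) (candidates P u) * d ^ suc k ∎
          where k = placedValency u P
        ... | no ¬uv = subst (λ c → length S ≤ c * d ^ placedValency u P)
          (sym (count-all (allows? v x u) (All.universal (λ y → (λ vu → contradiction (inj₂ vu) ¬uv) , λ uv → contradiction (inj₁ uv) ¬uv) (candidates P u))))
          (inv (there u∈L))

        -- Both w and w′ are unplaced and adjacent, so at most Δ neighbours of w are placed.
        one-free : ∀ {w w′} → w ∈ v ∷ L → w′ ∈ v ∷ L → Adjacent H w w′ → length S ≤ length (candidates P w) * d ^ Δ
        one-free {w} {w′} w∈ w′∈ adj = ≤-trans (inv w∈) (*-monoʳ-≤ (length (candidates P w)) (^-monoʳ-≤ d (≤-pred (begin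
          suc (placedValency w P)                       ≡⟨ +-comm 1 _ ⟩
          placedValency w P + 1                         ≤⟨ +-monoʳ-≤ (placedValency w P) (∈-length (∈-filter⁺ (adjacent? H w) w′∈ adj)) ⟩
          placedValency w P + valency H w (v ∷ L)       ≤⟨ deg w ⟩
          suc Δ                                         ∎))))

        -- Each fresh `x` ruins the candidates of some unplaced neighbour of `v`. One such neighbour
        -- `u` is ruined by a 1/`suc Δ` share of the fresh vertices: these form X, and the
        -- candidates of `u` form Y.
        fail : (∀ {x} → x ∈ fresh → Any (λ u → Bad u x) later) → SparsePair Δ d S
        fail allBad with pigeonhole bad? later fresh (suc Δ) fresh-nonempty later-few allBad
        ... | u , u∈later , large with ∈-filter⁻ (adjacent? H v) u∈later
        ...   | u∈L , vu = record
          { X = filter (bad? u) fresh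
          ; Y = candidates P u
          ; X-unique = filter⁺ (bad? u) (filter⁺ _ (candidates-unique P v))
          ; Y-unique = candidates-unique P u
          ; X⊆S = candidates-⊆ P v ∘ proj₁ ∘ ∈-filter⁻ (λ x → ¬? (x ∈? used)) ∘ proj₁ ∘ ∈-filter⁻ (bad? u)
          ; Y⊆S = candidates-⊆ P u
          ; X-large = begin
              length S                                ≤⟨ one-free (here refl) (there u∈L) vu ⟩
              length (candidates P v) * d ^ Δ         ≤⟨ *-monoˡ-≤ (d ^ Δ) (≤-trans fresh-half (*-monoʳ-≤ 2 large)) ⟩
              2 * (suc Δ * count (bad? u) fresh) * d ^ Δ ≡⟨ rearrange (suc Δ) (count (bad? u) fresh) (d ^ Δ) ⟩
              count (bad? u) fresh * (2 * suc Δ * d ^ Δ) ∎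
          ; Y-large = one-free (there u∈L) (here refl) (swap vu)
          ; sparse = sparse vu
          }
          where
          rearrange : ∀ a b c → 2 * (a * b) * c ≡ b * (2 * a * c)
          rearrange = solve-∀
          -- If `v ⟶ u`, the `y` that `x` allows for `u` are those without an edge from `y` to `x`.
          -- Badness makes them rare, so nearly all edges run from Y to X; the other orientation is
          -- the mirror image.
          sparse : Adjacent H v u → Sparse→ d (filter (bad? u) fresh) (candidates P u) ⊎
                                    Sparse← d (filter (bad? u) fresh) (candidates P u)
          sparse (inj₁ v⟶u) = inj₂ λ x∈ → ≤-trans
            (*-monoˡ-≤ d (count-mono _ (allows? v _ u) (λ ¬yx → (λ _ → ¬yx) , λ u⟶v → contradiction u⟶v (asymᴴ v⟶u)) (candidates P u)))
            (<⇒≤ (proj₂ (∈-filter⁻ (bad? u) {xs = fresh} x∈)))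
          sparse (inj₂ u⟶v) = inj₁ λ x∈ → ≤-trans
            (*-monoˡ-≤ d (count-mono _ (allows? v _ u) (λ ¬xy → (λ v⟶u → contradiction v⟶u (asymᴴ u⟶v)) , λ _ → ¬xy) (candidates P u)))
            (<⇒≤ (proj₂ (∈-filter⁻ (bad? u) {xs = fresh} x∈)))

        result : (∃[ x ] All (Compatible (v , x)) P × Inv ((v , x) ∷ P) L) ⊎ SparsePair Δ d S
        result with any? (λ x → All.all? (λ u → ¬? (bad? u x)) later) fresh
        ... | yes some = let x , x∈ , good = find some in inj₁ (x , compatible x∈ , continue good)
        ... | no none  = inj₂ (fail λ {x} x∈ →
          Any.map (λ {u} → decidable-stable (bad? u x)) (¬All⇒Any¬ (λ u → ¬? (bad? u x)) later (none ∘ lose x∈)))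

    copy-or-sparsePair : Copy H G ⊎ SparsePair Δ d S
    copy-or-sparsePair = greedy Inv step deg λ _ → ≤-reflexive (sym (*-identityʳ (length S)))

-- Choosing a vertex outside three small sets

∑-mono : ∀ {A : Set} {f g : A → ℕ} → (∀ x → f x ≤ g x) → ∀ xs → ∑ xs f ≤ ∑ xs g
∑-mono f≤g []       = z≤n
∑-mono f≤g (x ∷ xs) = +-mono-≤ (f≤g x) (∑-mono f≤g xs)

half+quarter+quarter : ∀ {a b c m l} → a * 2 ≤ l → b ≤ m → 4 * m < l → c * 4 ≤ l → a + (b + c) < l
half+quarter+quarter {a} {b} {c} {m} {l} 2a≤l b≤m 4m<l 4c≤l = *-cancelʳ-< 4 _ _ (begin-strict
  (a + (b + c)) * 4            ≡⟨ expand a b c ⟩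
  2 * (a * 2) + (4 * b + c * 4) ≤⟨ +-mono-≤ (*-monoʳ-≤ 2 2a≤l) (+-mono-≤ (*-monoʳ-≤ 4 b≤m) 4c≤l) ⟩
  2 * l + (4 * m + l)          <⟨ +-monoʳ-< (2 * l) (+-monoˡ-< l 4m<l) ⟩
  2 * l + (l + l)              ≡⟨ collect l ⟩
  l * 4                        ∎)
  where
  open ≤-Reasoning
  expand : ∀ a b c → (a + (b + c)) * 4 ≡ 2 * (a * 2) + (4 * b + c * 4)
  expand = solve-∀
  collect : ∀ a → 2 * a + (a + a) ≡ a * 4
  collect = solve-∀

-- The budget of a step of the second embedding: half for atypical vertices, less than a quarter for
-- used ones, a quarter for those clashing with placed neighbours. The strict inequality for the
-- second set leaves a vertex over.
avoid-three : ∀ {A : Set} {P Q R : A → Set} (P? : Decidable P) (Q? : Decidable Q) (R? : Decidable R) xs {m} →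
              count P? xs * 2 ≤ length xs → count Q? xs ≤ m → 4 * m < length xs → count R? xs * 4 ≤ length xs →
              ∃[ x ] ¬ (P x ⊎ Q x ⊎ R x)
avoid-three P? Q? R? xs few-P few-Q m-small few-R =
  let x , _ , ok = count-some P⊎Q⊎R? xs (≤-<-trans
        (≤-trans (count-⊎ P⊎Q⊎R? P? Q⊎R? id xs) (+-monoʳ-≤ (count P? xs) (count-⊎ Q⊎R? Q? R? id xs)))
        (half+quarter+quarter {count P? xs} {count Q? xs} {count R? xs} few-P few-Q m-small few-R))
  in x , ok
  where
  Q⊎R? = λ x → Q? x ⊎-dec R? x
  P⊎Q⊎R? = λ x → P? x ⊎-dec Q⊎R? x

AllPairs-lookup-< : ∀ {A : Set} {R : A → A → Set} {xs} → AllPairs R xs →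
                    ∀ {i j} → i Fin.< j → R (lookup xs i) (lookup xs j)
AllPairs-lookup-< (Rx ∷ _)  {zero}  {suc j} _         = All.lookup Rx (∈-lookup j)
AllPairs-lookup-< (_ ∷ pxs) {suc i} {suc j} (s≤s i<j) = AllPairs-lookup-< pxs i<j

-- Doubling the number of clusters

module _ {n N} (H : Digraph n) (G : Digraph N) (tournament : IsTournament G) (Δ : ℕ)
         (deg : ∀ w → valency H w (allFin n) ≤ suc Δ) where

  open Digraph H using () renaming (_⟶_ to _⟶ᴴ_; asym to asymᴴ)
  open Digraph G using () renaming (_⟶_ to _⟶ᴳ_)

  nonEdge? : ∀ x y → Dec (¬ x ⟶ᴳ y)
  nonEdge? x y = ¬? (T? _)

  -- An average over pairs rather than a bound per vertex, so by double counting it can be read from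
  -- either side.
  Dominates : ℕ → List (Fin N) → List (Fin N) → Set
  Dominates D X Y = ∑ X (λ x → count (nonEdge? x) Y) * D ≤ length X * length Y

  module _ (d D : ℕ) .{{_ : NonZero d}} .{{_ : NonZero D}} .{{_ : NonZero n}} where

    -- The inner factor is the loss from S to either side of a sparse pair; the leading 2 pays for
    -- deleting up to half of Y.
    growth : ℕ
    growth = 2 * (2 * suc Δ * d ^ Δ)

    record Clusters (k : ℕ) (S : List (Fin N)) : Set where
      field
        clusters : List (List (Fin N))
        number   : length clusters ≡ 2 ^ k
        ordered  : AllPairs (flip (Dominates D)) clusters
        unique   : ∀ {A} → A ∈ clusters → Unique A
        inside   : ∀ {A} → A ∈ clusters → ∀ {x} → x ∈ A → x ∈ S
        large    : ∀ {A} → A ∈ clusters → n * d ≤ length A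

    open Clusters

    widen : ∀ {k S T} → (∀ {x} → x ∈ S → x ∈ T) → Clusters k S → Clusters k T
    widen S⊆T C = record
      { clusters = clusters C
      ; number   = number C
      ; ordered  = ordered C
      ; unique   = unique C
      ; inside   = λ A∈ → S⊆T ∘ inside C A∈
      ; large    = large C
      }

    private
      instance
        growth≢0 : NonZero growth
        growth≢0 = m*n≢0 2 (2 * suc Δ * d ^ Δ) {{_}} {{m*n≢0 (2 * suc Δ) (d ^ Δ) {{_}} {{m^n≢0 d Δ}}}}

      module _ {R : Fin N → Fin N → Set} (R? : ∀ y x → Dec (R y x)) where

        record Refinement (k : ℕ) (X Y : List (Fin N)) : Set where
          field
            lower  : Clusters k X
            upper  : Clusters k Y
            sparse : ∀ {A B} → A ∈ clusters lower → B ∈ clusters upper →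
                     ∑ B (λ y → count (R? y) A) * D ≤ length B * length A

        module _ (k : ℕ) (big : 2 ^ suc k * D ≤ d)
          (recurse : ∀ S → Unique S → n * d * growth ^ k ≤ length S → Copy H G ⊎ Clusters k S) where

          -- The bound for each `x` survives in the clusters found inside X, so on average a `y`
          -- misses at most a 1/`d` share of each of them. Since there are `2 ^ k` such clusters,
          -- `big` lets `count-atypical` delete at most half of Y so that every remaining `y` misses
          -- at most 1/`D` of each. That bound holds vertex by vertex, hence for any clusters found
          -- later among the survivors. `R` stands for a missing edge in either direction.
          refine : ∀ X Y → Unique X → Unique Y →
                   2 * (n * d * growth ^ k) ≤ length X → 2 * (n * d * growth ^ k) ≤ length Y →
                   (∀ {x} → x ∈ X → count (λ y → R? y x) Y * d ≤ length Y) →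
                   Copy H G ⊎ Refinement k X Y
          refine X Y X-unique Y-unique X-large Y-large sparse
            with recurse X X-unique (≤-trans (m≤n*m _ 2) X-large)
          ... | inj₁ copy = inj₁ copy
          ... | inj₂ lower = trimmed
            where
            open ≤-Reasoning

            rejected? = λ y → any? (λ A → atypical? (λ _ → R?) id D A y) (clusters lower)
            Y′ = filter (¬? ∘ rejected?) Y

            few-rejected : count rejected? Y * 2 ≤ length Y
            few-rejected = count-atypical (λ _ → R?) id (clusters lower) Y
              (≤-trans (≤-reflexive (cong (λ m → 2 * m * D) (number lower))) big)
              (λ A∈ → ≤-trans (m*n≢0⇒>0 n d) (large lower A∈))
              λ {A} A∈ → begin
                ∑ Y (λ y → count (R? y) A) * d            ≡⟨ cong (_* d) (double-count R? Y A) ⟩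
                ∑ A (λ x → count (λ y → R? y x) Y) * d    ≤⟨ ∑-*-≤ A (sparse ∘ inside lower A∈) ⟩
                length A * length Y                       ≡⟨ *-comm (length A) _ ⟩
                length Y * length A                       ∎
              where
              m*n≢0⇒>0 : ∀ m n .{{_ : NonZero m}} .{{_ : NonZero n}} → 0 < m * n
              m*n≢0⇒>0 m n = >-nonZero⁻¹ (m * n) {{m*n≢0 m n}}

            Y′-large : n * d * growth ^ k ≤ length Y′
            Y′-large = *-cancelˡ-≤ 2 (≤-trans Y-large (+-cancelˡ-≤ (length Y) _ _ (begin
              length Y + length Y                                       ≡⟨ cong (λ l → l + l) (count-¬ rejected? Y) ⟩
              (c + length Y′) + (c + length Y′)                         ≡⟨ rearrange c (length Y′) ⟩
              c * 2 + 2 * length Y′                                     ≤⟨ +-monoˡ-≤ (2 * length Y′) few-rejected ⟩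
              length Y + 2 * length Y′                                  ∎)))
              where
              c = count rejected? Y
              rearrange : ∀ c l → (c + l) + (c + l) ≡ c * 2 + 2 * l
              rearrange = solve-∀

            trimmed : Copy H G ⊎ Refinement k X Y
            trimmed with recurse Y′ (filter⁺ (¬? ∘ rejected?) Y-unique) Y′-large
            ... | inj₁ copy  = inj₁ copy
            ... | inj₂ upper = inj₂ record
              { lower  = lower
              ; upper  = widen (proj₁ ∘ ∈-filter⁻ (¬? ∘ rejected?)) upper
              ; sparse = λ {A} {B} A∈ B∈ → ∑-*-≤ B λ {y} y∈ →
                  ≮⇒≥ (proj₂ (∈-filter⁻ (¬? ∘ rejected?) {xs = Y} (inside upper B∈ y∈)) ∘ lose A∈)
              }

      join : ∀ {k S X Y} → (∀ {x} → x ∈ X → x ∈ S) → (∀ {x} → x ∈ Y → x ∈ S) →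
             (C : Clusters k X) (C′ : Clusters k Y) →
             (∀ {A B} → A ∈ clusters C → B ∈ clusters C′ → Dominates D B A) → Clusters (suc k) S
      join {k} X⊆S Y⊆S C C′ dominates = record
        { clusters = clusters C ++ clusters C′
        ; number   = trans (length-++ (clusters C)) (cong₂ _+_ (number C) (trans (number C′) (sym (+-identityʳ _))))
        ; ordered  = AllPairs.++⁺ (ordered C) (ordered C′) (All.tabulate λ A∈ → All.tabulate (dominates A∈))
        ; unique   = λ A∈ → All.lookup (All.++⁺ (All.tabulate (unique C)) (All.tabulate (unique C′))) A∈
        ; inside   = λ A∈ x∈ → All.lookup (All.++⁺ {P = λ A → ∀ {x} → x ∈ A → x ∈ _}
            (All.tabulate λ A∈ → X⊆S ∘ inside C A∈) (All.tabulate λ A∈ → Y⊆S ∘ inside C′ A∈)) A∈ x∈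
        ; large    = λ A∈ → All.lookup (All.++⁺ (All.tabulate (large C)) (All.tabulate (large C′))) A∈
        }

    -- Each level splits S into a sparse pair and recurses on both sides. The same `d` and `D` are
    -- kept, as the requirement on `d` only weakens when `k` drops.
    copy-or-clusters : ∀ k → 2 ^ k * D ≤ d → ∀ S → Unique S → n * d * growth ^ k ≤ length S →
                       Copy H G ⊎ Clusters k S
    copy-or-clusters zero    big S S-unique S-large = inj₂ record
      { clusters = S ∷ []
      ; number   = refl
      ; ordered  = [] ∷ []
      ; unique   = λ { (here refl) → S-unique }
      ; inside   = λ { (here refl) x∈ → x∈ }
      ; large    = λ { (here refl) → ≤-trans (≤-reflexive (sym (*-identityʳ _))) S-large }
      }
    copy-or-clusters (suc k) big S S-unique S-large =
      [ inj₁ , double ]′ (copy-or-sparsePair H G tournament deg S S-unique (≤-trans threshold S-large))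
      where
      open ≤-Reasoning
      regroup : ∀ n d s D → 2 * n * (d * D) * s ≡ n * d * (2 * (s * D))
      regroup = solve-∀
      -- `growth` contains only `d ^ Δ`; the remaining factor `d` comes from the final cluster size
      -- `n * d`.
      threshold : 2 * n * d ^ suc Δ ≤ n * d * growth ^ suc k
      threshold = begin
        2 * n * (d * d ^ Δ)                    ≤⟨ m≤m*n _ (2 * suc Δ) ⟩
        2 * n * (d * d ^ Δ) * (2 * suc Δ)      ≡⟨ regroup n d (2 * suc Δ) (d ^ Δ) ⟩
        n * d * growth                         ≤⟨ *-monoʳ-≤ (n * d) (m≤m*n growth (growth ^ k) {{m^n≢0 growth k}}) ⟩
        n * d * growth ^ suc k                 ∎

      double : SparsePair H G Δ d S → Copy H G ⊎ Clusters (suc k) S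
      double pair = refined (SparsePair.sparse pair)
       where
       open SparsePair pair using (X; Y; X-unique; Y-unique; X⊆S; Y⊆S; X-large; Y-large)
       M = n * d * growth ^ k

       enough : ∀ {Z : List (Fin N)} → length S ≤ length Z * (2 * suc Δ * d ^ Δ) → 2 * M ≤ length Z
       enough {Z} S≤ = *-cancelʳ-≤ _ _ (2 * suc Δ * d ^ Δ) {{m*n≢0 (2 * suc Δ) (d ^ Δ) {{_}} {{m^n≢0 d Δ}}}} (begin
         2 * M * g                  ≡⟨ rearrange (n * d) (growth ^ k) g ⟩
         n * d * (2 * g * growth ^ k) ≤⟨ S-large ⟩
         length S                   ≤⟨ S≤ ⟩
         length Z * g               ∎)
         where
         g = 2 * suc Δ * d ^ Δ
         rearrange : ∀ a b g → 2 * (a * b) * g ≡ a * (2 * g * b)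
         rearrange = solve-∀

       X-enough : 2 * M ≤ length X
       X-enough = enough {X} X-large

       Y-enough : 2 * M ≤ length Y
       Y-enough = enough {Y} (≤-trans Y-large (*-monoʳ-≤ (length Y) (m≤n*m (d ^ Δ) (2 * suc Δ))))

       half : 2 ^ k * D ≤ d
       half = ≤-trans (*-monoˡ-≤ D (m≤n*m (2 ^ k) 2)) big

       refined : Sparse→ H G d X Y ⊎ Sparse← H G d X Y → Copy H G ⊎ Clusters (suc k) S
       -- Edges run from X to Y here, so the clusters in Y go first in the list, and the sums over
       -- `y` are turned into sums over `x`.
       refined (inj₁ sparse) = [ inj₁ , (λ r → let open Refinement r in
         inj₂ (join Y⊆S X⊆S upper lower λ {B} {A} B∈ A∈ → transpose {A} {B} (Refinement.sparse r A∈ B∈))) ]′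
           (refine (flip nonEdge?) k big (copy-or-clusters k half) X Y X-unique Y-unique X-enough Y-enough sparse)
         where
         transpose : ∀ {A B} → ∑ B (λ y → count (λ x → nonEdge? x y) A) * D ≤ length B * length A → Dominates D A B
         transpose {A} {B} few = begin
           ∑ A (λ x → count (nonEdge? x) B) * D             ≡⟨ cong (_* D) (double-count nonEdge? A B) ⟩
           ∑ B (λ y → count (λ x → nonEdge? x y) A) * D     ≤⟨ few ⟩
           length B * length A                              ≡⟨ *-comm (length B) _ ⟩
           length A * length B                              ∎
       refined (inj₂ sparse) = [ inj₁ , (λ r → let open Refinement r in
         inj₂ (join X⊆S Y⊆S lower upper (Refinement.sparse r))) ]′
           (refine nonEdge? k big (copy-or-clusters k half) X Y X-unique Y-unique X-enough Y-enough sparse)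

  -- Embedding an acyclic digraph along its levels

  module _ {D : ℕ} (As : List (List (Fin N))) (ordered : AllPairs (flip (Dominates D)) As)
    (unique : ∀ {A} → A ∈ As → Unique A) (large : ∀ {A} → A ∈ As → 4 * n < length A)
    (big : 2 * length As * (4 * suc Δ) ≤ D)
    (level : Fin n → Fin (length As)) (descends : ∀ {u v} → u ⟶ᴴ v → level v Fin.< level u) where

    private
      -- For `a` in cluster `i` and `b` in cluster `j`: the edge from the later to the earlier
      -- cluster is missing. Nothing is faulty within one cluster, which suffices because edges of H
      -- join distinct levels.
      Faulty : (i j : Fin (length As)) → Fin N → Fin N → Set
      Faulty i j a b = (i Fin.< j × ¬ b ⟶ᴳ a) ⊎ (j Fin.< i × ¬ a ⟶ᴳ b)

      abstract
        faulty? : ∀ i j a b → Dec (Faulty i j a b)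
        faulty? i j a b = (i <ᶠ? j ×-dec nonEdge? b a) ⊎-dec (j <ᶠ? i ×-dec nonEdge? a b)

      atypicalAt? : ∀ i a j → Dec (length (lookup As j) < count (faulty? i j a) (lookup As j) * (4 * suc Δ))
      atypicalAt? i a j = atypical? (faulty? i) (lookup As) (4 * suc Δ) j a

      Atypical : Fin (length As) → Fin N → Set
      Atypical i a = Any (λ j → length (lookup As j) < count (faulty? i j a) (lookup As j) * (4 * suc Δ)) (allFin (length As))

      atypicalIn? : ∀ i a → Dec (Atypical i a)
      atypicalIn? i a = any? (atypicalAt? i a) (allFin (length As))

      few-faults : ∀ i j → ∑ (lookup As i) (λ a → count (faulty? i j a) (lookup As j)) * D ≤
                           length (lookup As i) * length (lookup As j)
      few-faults i j with <ᶠ-cmp i j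
      ... | tri< i<j _ j≮i = begin
        ∑ Aᵢ (λ a → count (faulty? i j a) Aⱼ) * D
          ≤⟨ *-monoˡ-≤ D (∑-mono (λ a → count-mono (faulty? i j a) (λ b → nonEdge? b a)
               (λ { (inj₁ (_ , ¬ba)) → ¬ba ; (inj₂ (j<i , _)) → contradiction j<i j≮i }) Aⱼ) Aᵢ) ⟩
        ∑ Aᵢ (λ a → count (λ b → nonEdge? b a) Aⱼ) * D  ≡⟨ cong (_* D) (double-count (λ a b → nonEdge? b a) Aᵢ Aⱼ) ⟩
        ∑ Aⱼ (λ b → count (nonEdge? b) Aᵢ) * D          ≤⟨ AllPairs-lookup-< ordered i<j ⟩
        length Aⱼ * length Aᵢ                           ≡⟨ *-comm (length Aⱼ) _ ⟩
        length Aᵢ * length Aⱼ                           ∎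
        where
        open ≤-Reasoning
        Aᵢ = lookup As i
        Aⱼ = lookup As j
      ... | tri> i≮j _ j<i = ≤-trans
        (*-monoˡ-≤ D (∑-mono (λ a → count-mono (faulty? i j a) (nonEdge? a)
           (λ { (inj₁ (i<j , _)) → contradiction i<j i≮j ; (inj₂ (_ , ¬ab)) → ¬ab }) (lookup As j)) (lookup As i)))
        (AllPairs-lookup-< ordered j<i)
      ... | tri≈ i≮j _ j≮i = ∑-*-≤ (lookup As i) λ {a} _ → ≤-trans
        (≤-reflexive (cong (_* D) (count-none (faulty? i j a) (All.universal
          (λ { b (inj₁ (i<j , _)) → i≮j i<j ; b (inj₂ (j<i , _)) → j≮i j<i }) (lookup As j))))) z≤n

      few-atypical : ∀ i → count (atypicalIn? i) (lookup As i) * 2 ≤ length (lookup As i)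
      few-atypical i = count-atypical (faulty? i) (lookup As) (allFin (length As)) (lookup As i)
        (≤-trans (≤-reflexive (cong (λ m → 2 * m * (4 * suc Δ)) (length-tabulate {n = length As} id))) big)
        (λ {j} _ → ≤-trans (s≤s z≤n) (large (∈-lookup j)))
        (λ {j} _ → few-faults i j)

      Inv : Placement H G → List (Fin n) → Set
      Inv P _ = All (λ (w , z) → ¬ Atypical (level w) z) P

      step : ∀ P v L → length P + length (v ∷ L) ≤ n →
             (∀ w → placedValency H G w P + valency H w (v ∷ L) ≤ suc Δ) → Inv P (v ∷ L) →
             (∃[ x ] All (Compatible H G (v , x)) P × Inv ((v , x) ∷ P) L) ⊎ Copy H G
      step P v L len deg′ typical =
        let x , ok = avoid-three (atypicalIn? (level v)) (_∈? used) clash? home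
                       (few-atypical (level v)) few-used (large (∈-lookup (level v))) few-clashes
        in inj₁ (x , All.tabulate (compatible ok) , ok ∘ inj₁ ∷ typical)
        where
        open ≤-Reasoning
        open import Data.List.Membership.DecPropositional (_≟ᶠ_ {N}) using (_∈?_)
        home = lookup As (level v)
        used = map proj₂ P
        neighbours = filter (adjacent? H v ∘ proj₁) P
        Fault : Fin n × Fin N → Fin N → Set
        Fault (w , z) = Faulty (level w) (level v) z
        fault? : ∀ wz x → Dec (Fault wz x)
        fault? (w , z) x = faulty? (level w) (level v) z x
        clash? = λ x → any? (λ wz → fault? wz x) neighbours

        few-used : count (_∈? used) home ≤ n
        few-used = begin
          count (_∈? used) home  ≤⟨ count-∈ _≟ᶠ_ used (unique (∈-lookup (level v))) ⟩
          length used         ≡⟨ length-map proj₂ P ⟩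
          length P            ≤⟨ m≤m+n (length P) _ ⟩
          length P + length (v ∷ L) ≤⟨ len ⟩
          n                   ∎

        -- Images of placed neighbours are typical, so each excludes at most a 1/(4(Δ+1)) share of
        -- `home`, and there are at most Δ+1 of them. The new image is chosen typical for the sake
        -- of neighbours still to come.
        few-clashes : count clash? home * 4 ≤ length home
        few-clashes = *-cancelʳ-≤ _ _ (suc Δ) (begin
          count clash? home * 4 * suc Δ      ≡⟨ *-assoc (count clash? home) 4 (suc Δ) ⟩
          count clash? home * (4 * suc Δ)    ≤⟨ count-any fault? neighbours home few ⟩
          length neighbours * length home    ≤⟨ *-monoˡ-≤ (length home) (≤-trans (m≤m+n (length neighbours) _) (deg′ v)) ⟩
          suc Δ * length home                ≡⟨ *-comm (suc Δ) _ ⟩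
          length home * suc Δ                ∎)
          where
          few : ∀ {wz} → wz ∈ neighbours → count (fault? wz) home * (4 * suc Δ) ≤ length home
          few wz∈ = ≮⇒≥ (All.lookup typical (proj₁ (∈-filter⁻ (adjacent? H v ∘ proj₁) wz∈)) ∘ lose (∈-allFin (level v)))

        compatible : ∀ {x} → ¬ (Atypical (level v) x ⊎ x ∈ used ⊎ Any (λ wz → Fault wz x) neighbours) →
                     ∀ {wz} → wz ∈ P → Compatible H G (v , x) wz
        compatible ok {w , z} wz∈P =
            (λ { refl → ok (inj₂ (inj₁ (∈-map⁺ proj₂ wz∈P))) })
          , (λ v⟶w → decidable-stable (T? _) λ ¬xz → ok (inj₂ (inj₂ (lose (∈-filter⁺ (adjacent? H v ∘ proj₁) wz∈P (inj₁ v⟶w)) (inj₁ (descends v⟶w , ¬xz))))))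
          , (λ w⟶v → decidable-stable (T? _) λ ¬zx → ok (inj₂ (inj₂ (lose (∈-filter⁺ (adjacent? H v ∘ proj₁) wz∈P (inj₂ w⟶v)) (inj₂ (descends w⟶v , ¬zx))))))

    copy-in-clusters : Copy H G
    -- No step gets stuck, so `Fail` is simply taken to be the goal.
    copy-in-clusters = [ id , id ]′ (greedy H G Inv step deg [])

-- Extremal numbers, and levels by longest walks

greatest : ∀ {P : ℕ → Set} → Decidable P → P 0 → ∀ m → ∃[ j ] P j × (∀ {i} → i ≤ m → P i → i ≤ j)
greatest P? p₀ zero = 0 , p₀ , λ i≤0 _ → i≤0
greatest P? p₀ (suc m) with P? (suc m)
... | yes p = suc m , p , λ i≤ _ → i≤
... | no ¬p with greatest P? p₀ m
...   | j , pⱼ , top = j , pⱼ , λ i≤ pᵢ → [ (λ i<1+m → top (≤-pred i<1+m) pᵢ) , (λ { refl → contradiction pᵢ ¬p }) ]′ (m≤n⇒m<n∨m≡n i≤)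

least : ∀ {P : ℕ → Set} → Decidable P → ∀ n → P n → ∃[ r ] P r × (∀ m → P m → r ≤ m)
least P? zero    p = 0 , p , λ _ _ → z≤n
least P? (suc n) p with P? 0
... | yes p₀ = 0 , p₀ , λ _ _ → z≤n
... | no ¬p₀ with least (P? ∘ suc) n p
...   | r , pᵣ , minimal = suc r , pᵣ , λ { zero p₀ → contradiction p₀ ¬p₀ ; (suc m) pₘ → s≤s (minimal m pₘ) }

module _ {n} (H : Digraph n) (acyclic : Acyclic H) where

  open Digraph H using (_⟶_)

  private
    -- `us` is the part of `vs` before `v`. The start `w` is independent of `v` so that the
    -- induction can advance along the walk; for `w` equal to `v` the result is a directed cycle.
    first-return : ∀ {v w vs} → v ∈ vs → Unique vs → Linked _⟶_ (w ∷ vs) →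
                   ∃[ us ] Unique us × All (v ≢_) us × (∀ {u} → u ∈ us → u ∈ vs) × Linked _⟶_ ((w ∷ us) ∷ʳ v)
    first-return (here refl) _ (wv ∷ _) = [] , [] , [] , (λ ()) , wv ∷ [-]
    first-return (there v∈) (y∉ ∷ uniq) (wy ∷ walk) with first-return v∈ uniq walk
    ... | us , us-uniq , v∉us , us⊆ , linked =
        _ ∷ us
      , All.tabulate (All.lookup y∉ ∘ us⊆) ∷ us-uniq
      , (λ { refl → All.lookup y∉ v∈ refl }) ∷ v∉us
      , (λ { (here eq) → here eq ; (there u∈) → there (us⊆ u∈) })
      , wy ∷ linked

  walk-unique : ∀ {vs} → Linked _⟶_ vs → Unique vs
  walk-unique []  = []
  walk-unique [-] = [] ∷ []
  walk-unique {v ∷ vs} walk@(_ ∷ walk′) = ¬Any⇒All¬ vs v∉vs ∷ walk-unique walk′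
    where
    v∉vs : v ∉ vs
    v∉vs v∈vs with first-return v∈vs (walk-unique walk′) walk
    ... | us , us-uniq , v∉us , _ , cycle = acyclic v us (v∉us ∷ us-uniq , cycle)

  -- A walk with `j` edges, hence `suc j` vertices. Recursion on `j` makes existence decidable by
  -- search, and `walk-unique` turns such walks into paths, so the height bounds them.
  Walk : ℕ → Fin n → Set
  Walk zero    v = ⊤
  Walk (suc j) v = ∃[ u ] v ⟶ u × Walk j u

  walk? : ∀ j v → Dec (Walk j v)
  walk? zero    v = yes tt
  walk? (suc j) v = Fin.any? λ u → T? _ ×-dec walk? j u

  walk-vertices : ∀ j {v} → Walk j v → ∃[ vs ] Linked _⟶_ (v ∷ vs) × length vs ≡ j
  walk-vertices zero    _              = [] , [-] , refl
  walk-vertices (suc j) (u , vu , walk) with walk-vertices j walk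
  ... | vs , linked , len = u ∷ vs , vu ∷ linked , cong suc len

  module _ {h} (height : HasHeight H h) where

    walk-bounded : ∀ {j v} → Walk j v → j < h
    walk-bounded {j} walk with walk-vertices j walk
    ... | vs , linked , refl = proj₂ height _ (walk-unique linked , linked)

    private
      longest : ∀ v → ∃[ j ] Walk j v × (∀ {i} → i ≤ h → Walk i v → i ≤ j)
      longest v = greatest (λ j → walk? j v) tt h

    level : Fin n → ℕ
    level = proj₁ ∘ longest

    level<h : ∀ v → level v < h
    level<h v = walk-bounded {v = v} (proj₁ (proj₂ (longest v)))

    level-descends : ∀ {u v} → u ⟶ v → level v < level u
    -- A longest walk from `v`, extended by the edge at its front, is still shorter than `h` and so
    -- lies within the range searched for `u`.
    level-descends {u} {v} uv = proj₂ (proj₂ (longest u)) (<⇒≤ (walk-bounded {v = u} walk)) walk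
      where
      walk : Walk (suc (level v)) u
      walk = v , uv , proj₁ (proj₂ (longest v))

-- Degrees as list counts, and digraphs without edges

count-T : ∀ {A : Set} {m} (g : A → Bool) (f : Fin m → A) →
          count (T? ∘ g) (tabulate f) ≡ ∣ Vec.tabulate (g ∘ f) ∣
count-T {m = zero}  g f = refl
count-T {m = suc m} g f with g (f zero)
... | true  = cong suc (count-T g (f ∘ suc))
... | false = count-T g (f ∘ suc)

module _ {n} (H : Digraph n) where

  open Digraph H using (adj; _⟶_; asym; degree)

  valency≤maxDegree : ∀ v → valency H v (allFin n) ≤ maxDegree H
  valency≤maxDegree v = ≤-trans
    (count-⊎ (adjacent? H v) (T? ∘ adj v) (λ u → T? (adj u v)) id (allFin n))
    (≤-trans (≤-reflexive (cong₂ _+_ (count-T (adj v) id) (count-T (λ u → adj u v) id)))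
             (All.lookup (xs≤max 0 (map degree (allFin n))) (∈-map⁺ degree (∈-allFin v))))

  edge⇒maxDegree>0 : ∀ {u v} → u ⟶ v → 0 < maxDegree H
  edge⇒maxDegree>0 {u} {v} uv =
    ≤-trans (∈-length (∈-filter⁺ (adjacent? H u) (∈-allFin v) (inj₁ uv))) (valency≤maxDegree u)

  edgeless⇒copy : (∀ u v → ¬ u ⟶ v) → InEveryTournament H n
  edgeless⇒copy edgeless _ _ = id , id , λ {u} {v} uv → contradiction uv (edgeless u v)

-- Existence of the Ramsey number by exhaustive search

Searchable : Set → Set₁
Searchable A = ∀ {P : A → Set} → Decidable P → Dec (∃ P)

searchVec : ∀ {A} → Searchable A → ∀ n → Searchable (Vec A n)
searchVec search zero    P? = map′ ([] ,_) (λ { ([] , p) → p }) (P? [])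
searchVec search (suc n) P? = map′ (λ { (x , xs , p) → x ∷ xs , p }) (λ { (x ∷ xs , p) → x , xs , p })
  (search λ x → searchVec search n (P? ∘ (x ∷_)))

module _ {n} (H : Digraph n) {N : ℕ} where

  open Digraph H using (_⟶_)

  private
    CopyIn : (Fin N → Fin N → Bool) → Set
    CopyIn adj = Σ[ f ∈ (Fin n → Fin N) ] Injective _≡_ _≡_ f × (∀ {u v} → u ⟶ v → T (adj (f u) (f v)))

    copyIn? : ∀ adj → Dec (CopyIn adj)
    copyIn? adj = map′
      (λ { (w , ok) → Vec.lookup w , (λ {u} {v} → proj₁ (ok u v)) , (λ {u} {v} → proj₂ (ok u v)) })
      (λ { (f , inj , edges) → Vec.tabulate f , λ u v →
             subst₂ (λ x y → (x ≡ y → u ≡ v) × (u ⟶ v → T (adj x y)))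
               (sym (lookup∘tabulate f u)) (sym (lookup∘tabulate f v)) (inj , edges) })
      (searchVec Fin.any? n λ w → Fin.all? λ u → Fin.all? λ v →
        ((Vec.lookup w u ≟ᶠ Vec.lookup w v) →-dec (u ≟ᶠ v)) ×-dec (T? _ →-dec T? _))

    Avoids : (Fin N → Fin N → Bool) → Set
    Avoids adj = (∀ u v → (T (adj u v) → ¬ T (adj v u)) × (u ≢ v → T (adj u v) ⊎ T (adj v u))) × ¬ CopyIn adj

    avoids? : ∀ adj → Dec (Avoids adj)
    avoids? adj = (Fin.all? λ u → Fin.all? λ v →
      (T? _ →-dec ¬? (T? _)) ×-dec (¬? (u ≟ᶠ v) →-dec (T? _ ⊎-dec T? _))) ×-dec ¬? (copyIn? adj)

    entry : Vec (Vec Bool N) N → Fin N → Fin N → Bool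
    entry m u v = Vec.lookup (Vec.lookup m u) v

    entry∘tabulate : ∀ adj u v → entry (Vec.tabulate (Vec.tabulate ∘ adj)) u v ≡ adj u v
    entry∘tabulate adj u v = trans (cong (λ row → Vec.lookup row v) (lookup∘tabulate (Vec.tabulate ∘ adj) u))
                                   (lookup∘tabulate (adj u) v)

  -- Taking a least N constructively needs this decision. Tournaments are enumerated as Boolean
  -- matrices and compared with arbitrary adjacency functions entry by entry.
  inEveryTournament? : Dec (InEveryTournament H N)
  -- A subset is a Boolean vector, so `anySubset?` searches the possible rows.
  inEveryTournament? with searchVec anySubset? N (avoids? ∘ entry)
  ... | yes (m , oriented , none) = no λ every →
    none (every (record { adj = entry m ; asym = λ {u} {v} → proj₁ (oriented u v) }) (λ {u} {v} → proj₂ (oriented u v)))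
  ... | no ¬avoids = yes λ G tournament →
    let open Digraph G using (adj; asym)
        eq = λ u v → sym (entry∘tabulate adj u v)
    in decidable-stable (copyIn? adj) λ none → ¬avoids
      ( Vec.tabulate (Vec.tabulate ∘ adj)
      , (λ u v → subst₂ (λ a b → (T a → ¬ T b) × (u ≢ v → T a ⊎ T b)) (eq u v) (eq v u) (asym , tournament))
      , λ { (f , inj , edges) → none (f , inj , λ {u} {v} uv → subst T (entry∘tabulate adj (f u) (f v)) (edges uv)) } )

ramseyNumber : ∀ {n} (H : Digraph n) N → InEveryTournament H N → ∃[ r ] IsRamseyNumber H r × r ≤ N
ramseyNumber H N every with least (λ N → inEveryTournament? H {N}) N every
... | r , holds , minimal = r , (holds , minimal) , minimal N every

-- For maximum degree Δ + 1 and height at most 2 ^ K.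
clusterRatio ramseyConstant : ℕ → ℕ → ℕ
clusterRatio Δ K = 2 ^ K * (2 * 2 ^ K * (4 * suc Δ))
ramseyConstant Δ K = clusterRatio Δ K * (2 * (2 * suc Δ * clusterRatio Δ K ^ Δ)) ^ K

-- A sufficient tournament size, linear in n

module _ {n h Δ K} (H : Digraph n) .{{_ : NonZero n}} (acyclic : Acyclic H) (height : HasHeight H h)
         (Δ≡ : maxDegree H ≡ suc Δ) (h≤ : h ≤ 2 ^ K) where

  private
    -- `D` is what the embedding into `2 ^ K` clusters asks for, and `d` is the least value that
    -- allows K doublings.
    D d : ℕ
    D = 2 * 2 ^ K * (4 * suc Δ)
    d = 2 ^ K * D

    instance
      2^K≢0 : NonZero (2 ^ K)
      2^K≢0 = m^n≢0 2 K
      D≢0 : NonZero D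
      D≢0 = m*n≢0 (2 * 2 ^ K) (4 * suc Δ) {{m*n≢0 2 (2 ^ K)}}
      d≢0 : NonZero d
      d≢0 = m*n≢0 (2 ^ K) D

    8≤d : 8 ≤ d
    8≤d = ≤-trans (*-mono-≤ {2} {2 * 2 ^ K} {4} {4 * suc Δ} (m≤m*n 2 (2 ^ K)) (m≤m*n 4 (suc Δ))) (m≤n*m D (2 ^ K))

    4n<nd : 4 * n < n * d
    4n<nd = <-≤-trans (<-≤-trans (*-monoˡ-< n {4} {8} (s≤s (s≤s (s≤s (s≤s (s≤s z≤n)))))) (≤-reflexive (*-comm 8 n))) (*-monoʳ-≤ n 8≤d)

    deg : ∀ v → valency H v (allFin n) ≤ suc Δ
    deg v = ≤-trans (valency≤maxDegree H v) (≤-reflexive Δ≡)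

  ramseyConstant-suffices : InEveryTournament H (n * ramseyConstant Δ K)
  ramseyConstant-suffices G tournament =
    [ id , embed ]′ (copy-or-clusters H G tournament Δ deg d D K ≤-refl (allFin N) (allFin⁺ N)
      (≤-reflexive (trans (*-assoc n d _) (sym (length-tabulate {n = N} id)))))
    where
    N = n * ramseyConstant Δ K
    embed : Clusters H G tournament Δ deg d D K (allFin N) → Copy H G
    embed C = copy-in-clusters H G tournament Δ deg clusters ordered unique
      (<-≤-trans 4n<nd ∘ large)
      (≤-reflexive (cong (λ m → 2 * m * (4 * suc Δ)) number))
      (λ v → fromℕ< (in-range v))
      (λ {u} {v} uv → subst₂ _<_ (sym (Fin.toℕ-fromℕ< (in-range v))) (sym (Fin.toℕ-fromℕ< (in-range u)))
                        (level-descends H acyclic height uv))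
      where
      open Clusters C
      in-range : ∀ v → level H acyclic height v < length clusters
      in-range v = <-≤-trans (level<h H acyclic height v) (≤-trans h≤ (≤-reflexive (sym number)))

-- Estimating the constant as a power of Δh

2^log : ∀ h → ∃[ k ] 2 ^ k < 2 + h × 2 + h ≤ 2 ^ suc k
2^log zero    = 0 , s≤s (s≤s z≤n) , ≤-refl
2^log (suc h) with 2^log h
... | k , lower , upper with 3 + h ≤? 2 ^ suc k
...   | yes upper′ = k , m≤n⇒m≤1+n lower , upper′
-- The old upper bound was attained, so the next height passes a power of 2.
...   | no ¬upper′ = suc k , ≰⇒> ¬upper′ , (begin
  3 + h                    ≤⟨ +-monoʳ-≤ 1 upper ⟩
  1 + 2 ^ suc k            ≤⟨ +-monoˡ-≤ (2 ^ suc k) (m^n>0 2 (suc k)) ⟩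
  2 ^ suc k + 2 ^ suc k    ≡⟨ cong (2 ^ suc k +_) (+-identityʳ (2 ^ suc k)) ⟨
  2 ^ suc (suc k)          ∎)
  where open ≤-Reasoning

2^-cancel-≤ : ∀ {m n} → 2 ^ m ≤ 2 ^ n → m ≤ n
2^-cancel-≤ 2ᵐ≤2ⁿ = ≮⇒≥ (λ n<m → <⇒≱ (^-monoʳ-< 2 (s≤s (s≤s z≤n)) n<m) 2ᵐ≤2ⁿ)

^-distribʳ-* : ∀ m n o → (m * n) ^ o ≡ m ^ o * n ^ o
^-distribʳ-* m n zero    = refl
^-distribʳ-* m n (suc o) = trans (cong (m * n *_) (^-distribʳ-* m n o)) (swap-middle m n (m ^ o) (n ^ o))
  where
  swap-middle : ∀ a b c d → a * b * (c * d) ≡ a * c * (b * d)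
  swap-middle = solve-∀

module _ (Δ h k : ℕ) (2ᵏ≤ : 2 ^ k ≤ suc h) where

  open ≤-Reasoning

  private
    b = suc Δ * (2 + h)
    d = clusterRatio Δ (suc k)

    h+2≤b : 2 + h ≤ b
    h+2≤b = m≤n*m (2 + h) (suc Δ)

    4[h+1]≤b² : 4 * suc h ≤ (2 + h) * (2 + h)
    4[h+1]≤b² = subst (4 * suc h ≤_) (sym (square h)) (m≤m+n _ _)
      where
      square : ∀ h → (2 + h) * (2 + h) ≡ 4 * suc h + h * h
      square = solve-∀

    -- By `2 ^ k ≤ suc h`, `d` is at most (4(h+1))² · 2(Δ+1). Since 4(h+1) ≤ (h+2)², the first part
    -- gives four factors `2 + h`, and 2(Δ+1) is at most one factor `b`.
    d≤b⁵ : d ≤ b ^ 5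
    d≤b⁵ = begin
      2 * 2 ^ k * (2 * (2 * 2 ^ k) * (4 * suc Δ))   ≤⟨ *-mono-≤ (*-monoʳ-≤ 2 2ᵏ≤) (*-monoˡ-≤ (4 * suc Δ) (*-monoʳ-≤ 2 (*-monoʳ-≤ 2 2ᵏ≤))) ⟩
      2 * suc h * (2 * (2 * suc h) * (4 * suc Δ))   ≡⟨ regroup (suc h) (suc Δ) ⟩
      (4 * suc h) * (4 * suc h) * (suc Δ * 2)       ≤⟨ *-mono-≤ (*-mono-≤ 4[h+1]≤b² 4[h+1]≤b²) (*-monoʳ-≤ (suc Δ) (m≤m+n 2 h)) ⟩
      (g * g) * (g * g) * b                         ≤⟨ *-monoˡ-≤ b (*-mono-≤ (*-mono-≤ h+2≤b h+2≤b) (*-mono-≤ h+2≤b h+2≤b)) ⟩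
      (b * b) * (b * b) * b                         ≡⟨ fifth b ⟩
      b ^ 5                                         ∎
      where
      g = 2 + h
      regroup : ∀ h Δ → 2 * h * (2 * (2 * h) * (4 * Δ)) ≡ (4 * h) * (4 * h) * (Δ * 2)
      regroup = solve-∀
      fifth : ∀ b → (b * b) * (b * b) * b ≡ b * (b * (b * (b * (b * 1))))
      fifth = solve-∀

    4Δ≤b² : 2 * (2 * suc Δ) ≤ b * b
    4Δ≤b² = begin
      2 * (2 * suc Δ)       ≡⟨ regroup (suc Δ) ⟩
      2 * (suc Δ * 2)       ≤⟨ *-mono-≤ (≤-trans (m≤m+n 2 h) h+2≤b) (*-monoʳ-≤ (suc Δ) (m≤m+n 2 h)) ⟩
      b * b                 ∎
      where
      regroup : ∀ a → 2 * (2 * a) ≡ 2 * (a * 2)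
      regroup = solve-∀

    growth≤ : 2 * (2 * suc Δ * d ^ Δ) ≤ b ^ (2 + 5 * Δ)
    growth≤ = begin
      2 * (2 * suc Δ * d ^ Δ)    ≡⟨ *-assoc 2 (2 * suc Δ) (d ^ Δ) ⟨
      2 * (2 * suc Δ) * d ^ Δ    ≤⟨ *-mono-≤ 4Δ≤b² (^-monoˡ-≤ Δ d≤b⁵) ⟩
      b * b * (b ^ 5) ^ Δ        ≡⟨ cong₂ _*_ (cong (b *_) (sym (*-identityʳ b))) (^-*-assoc b 5 Δ) ⟩
      b ^ 2 * b ^ (5 * Δ)        ≡⟨ ^-distribˡ-+-* b 2 (5 * Δ) ⟨
      b ^ (2 + 5 * Δ)            ∎

  ramseyConstant≤ : ramseyConstant Δ (suc k) ≤ b ^ (5 + (2 + 5 * Δ) * suc k)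
  ramseyConstant≤ = begin
    d * (2 * (2 * suc Δ * d ^ Δ)) ^ suc k    ≤⟨ *-mono-≤ d≤b⁵ (^-monoˡ-≤ (suc k) growth≤) ⟩
    b ^ 5 * (b ^ (2 + 5 * Δ)) ^ suc k        ≡⟨ cong (b ^ 5 *_) (^-*-assoc b (2 + 5 * Δ) (suc k)) ⟩
    b ^ 5 * b ^ ((2 + 5 * Δ) * suc k)        ≡⟨ ^-distribˡ-+-* b 5 ((2 + 5 * Δ) * suc k) ⟨
    b ^ (5 + (2 + 5 * Δ) * suc k)            ∎

-- Rounding log₂ h up costs at most a factor 2 for h > 2 and nothing for h = 2.
integer-exponent : ∀ Δ h k → 2 ^ k < 2 + h →
  ∃[ j ] 2 ^ j ≤ 2 + h × 5 + (2 + 5 * Δ) * suc k ≤ 10 * suc Δ * j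
integer-exponent Δ h zero    _  = 1 , m≤m+n 2 h , subst (5 + (2 + 5 * Δ) * 1 ≤_) (sym (slack Δ)) (m≤m+n _ _)
  where
  slack : ∀ Δ → 10 * suc Δ * 1 ≡ 5 + (2 + 5 * Δ) * 1 + (3 + 5 * Δ)
  slack = solve-∀
integer-exponent Δ h (suc k) lt = suc k , <⇒≤ lt , subst (5 + (2 + 5 * Δ) * suc (suc k) ≤_) (sym (slack Δ k)) (m≤m+n _ _)
  where
  slack : ∀ Δ k → 10 * suc Δ * suc k ≡ 5 + (2 + 5 * Δ) * suc (suc k) + (1 + 8 * k + 5 * (Δ * k))
  slack = solve-∀

-- An integer `j` with `2 ^ j ≤ 2 + h` lies below every rational `p`/`q` in the upper cut of log₂(2
-- + h), because 2^(jq) ≤ (2+h)^q ≤ 2^p. So an integer exponent suffices.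
power-bound : ∀ {Δ h k r n} → 2 ^ k < 2 + h → r ≤ n * ramseyConstant Δ (suc k) →
              r ≤⟦ suc Δ * (2 + h) ^⟨ 10 * suc Δ log₂ 2 + h ⟩· n ⟧
power-bound {Δ} {h} {k} {r} {n} lower r≤ p q hq≤2p with integer-exponent Δ h k lower
... | j , 2ʲ≤ , exponent≤ = begin
  r ^ q                                  ≤⟨ ^-monoˡ-≤ q r≤ ⟩
  (n * ramseyConstant Δ (suc k)) ^ q     ≡⟨ ^-distribʳ-* n (ramseyConstant Δ (suc k)) q ⟩
  n ^ q * ramseyConstant Δ (suc k) ^ q   ≡⟨ *-comm (n ^ q) _ ⟩
  ramseyConstant Δ (suc k) ^ q * n ^ q   ≤⟨ *-monoˡ-≤ (n ^ q) (begin
    ramseyConstant Δ (suc k) ^ q           ≤⟨ ^-monoˡ-≤ q (≤-trans (ramseyConstant≤ Δ h k (≤-pred lower)) (^-monoʳ-≤ b exponent≤)) ⟩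
    (b ^ (10 * suc Δ * j)) ^ q             ≡⟨ ^-*-assoc b (10 * suc Δ * j) q ⟩
    b ^ (10 * suc Δ * j * q)               ≡⟨ cong (b ^_) (*-assoc (10 * suc Δ) j q) ⟩
    b ^ (10 * suc Δ * (j * q))             ≤⟨ ^-monoʳ-≤ b (*-monoʳ-≤ (10 * suc Δ) jq≤p) ⟩
    b ^ (10 * suc Δ * p)                   ∎) ⟩
  b ^ (10 * suc Δ * p) * n ^ q           ∎
  where
  open ≤-Reasoning
  b = suc Δ * (2 + h)
  jq≤p : j * q ≤ p
  jq≤p = 2^-cancel-≤ (begin
    2 ^ (j * q)     ≡⟨ ^-*-assoc 2 j q ⟨
    (2 ^ j) ^ q     ≤⟨ ^-monoˡ-≤ q 2ʲ≤ ⟩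
    (2 + h) ^ q     ≤⟨ hq≤2p ⟩
    2 ^ p           ∎)

-- Both bounds, with edgeless digraphs apart

edgeless-bound : ∀ {n Δ h r} {H : Digraph n} → HasHeight H h → r ≤ n →
                 r ≤⟦ Δ * h ^⟨ 10 * Δ log₂ h ⟩· n ⟧
edgeless-bound {zero}  _ z≤n p (suc q) _ = z≤n
edgeless-bound {suc n} {Δ} {h} {r} height r≤n p q _ =
  ≤-trans (^-monoˡ-≤ q r≤n) (m≤n*m (suc n ^ q) _ {{base^≢0 Δ}})
  where
  h>0 : 0 < h
  h>0 = proj₂ height (zero ∷ []) ([] ∷ [] , [-])
  base^≢0 : ∀ Δ → NonZero ((Δ * h) ^ (10 * Δ * p))
  -- The base is 0, but so is the exponent, and the power is 1.
  base^≢0 zero    = _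
  base^≢0 (suc Δ) = m^n≢0 (suc Δ * h) (10 * suc Δ * p) {{m*n≢0 (suc Δ) h {{_}} {{>-nonZero h>0}}}}

-- The outer `suc` keeps the constant positive, which covers edgeless digraphs. An edge forces
-- maximum degree at least 1 and height at least 2, so for all others `pred` and `∸ 2` truncate
-- nothing.
linearConstant : ℕ → ℕ → ℕ
linearConstant Δ h = suc (ramseyConstant (pred Δ) (suc (proj₁ (2^log (h ∸ 2)))))

ramsey-bound : ∀ {n Δ h} (H : Digraph n) → Acyclic H → maxDegree H ≡ Δ → HasHeight H h →
  ∃[ r ] IsRamseyNumber H r × r ≤⟦ (Δ * h) ^⟨ (10 * Δ) log₂ h ⟩· n ⟧ × r ≤ linearConstant Δ h * n
ramsey-bound {n} {Δ} {h} H acyclic Δ≡ height with Fin.any? (λ u → Fin.any? λ v → T? (Digraph.adj H u v))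
... | no edgeless =
  let r , ramsey , r≤n = ramseyNumber H n (edgeless⇒copy H λ u v uv → edgeless (u , v , uv))
  in r , ramsey , edgeless-bound {Δ = Δ} {H = H} height r≤n , ≤-trans r≤n (m≤m+n n _)
... | yes (u , v , uv) = linear n Δ h u H acyclic Δ≡ height
    (subst (0 <_) Δ≡ (edge⇒maxDegree>0 H uv))
    (walk-bounded H acyclic height {v = u} (v , uv , _))
  where
  linear : ∀ n Δ h (u : Fin n) (H : Digraph n) → Acyclic H → maxDegree H ≡ Δ → HasHeight H h → 0 < Δ → 1 < h →
    ∃[ r ] IsRamseyNumber H r × r ≤⟦ (Δ * h) ^⟨ (10 * Δ) log₂ h ⟩· n ⟧ × r ≤ linearConstant Δ h * n
  linear (suc n) (suc Δ) (suc (suc h)) _ H acyclic Δ≡ height _ _ =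
    let k , lower , upper = 2^log h
        C = ramseyConstant Δ (suc k)
        r , ramsey , r≤ = ramseyNumber H (suc n * C) (ramseyConstant-suffices {K = suc k} H acyclic height Δ≡ upper)
    in r , ramsey , power-bound {Δ} {h} {k} {n = suc n} lower r≤ ,
       ≤-trans r≤ (≤-trans (≤-reflexive (*-comm (suc n) C)) (*-monoˡ-≤ (suc n) (n≤1+n C)))
  linear (suc n) (suc Δ) (suc zero) _ _ _ _ _ _ (s≤s ())

theorem1p4 : (∀ n Δ h (H : Digraph n) →
    Acyclic H → maxDegree H ≡ Δ → HasHeight H h →
    ∃[ r ] IsRamseyNumber H r × r ≤⟦ (Δ * h) ^⟨ (10 * Δ) log₂ h ⟩· n ⟧)
    ×
    (∀ Δ h → ∃[ C ]
    ∀ n (H : Digraph n) →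
    Acyclic H → maxDegree H ≡ Δ → HasHeight H h →
    ∃[ r ] IsRamseyNumber H r × r ≤ C * n)
theorem1p4 =
    (λ n Δ h H acyclic Δ≡ height → let r , ramsey , bound , _ = ramsey-bound H acyclic Δ≡ height in r , ramsey , bound)
  , (λ Δ h → linearConstant Δ h , λ n H acyclic Δ≡ height →
      let r , ramsey , _ , bound = ramsey-bound H acyclic Δ≡ height in r , ramsey , bound)
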